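{- Let $G=(V,E)$ be a finite Eulerian graph (every vertex has even degree). For $A\subseteq E$ let $\varepsilon(A)$ denote the number of Eulerian orientations of $(V,A)$ and $h(A)$ the number of half graphs of $(V,A)$. Let $G\times K_2$ be the bipartite double cover of $G$. Then $$\varepsilon(G\times K_2)=h(G\times K_2)=\sum_{A\subseteq E}\varepsilon(A)\,h(E\setminus A).$$
   Context: An Eulerian orientation of a graph is an orientation in which every vertex has in-degree equal to out-degree. A half graph of a graph $F$ is a subset $S$ of its edges such that every vertex $v$ is incident to exactly $d_F(v)/2$ edges of $S$. The bipartite double cover $G\times K_2$ has vertex set $V\times\{0,1\}$, and for every edge $uv\in E$ it contains the two edges $(u,0)(v,1)$ and $(u,1)(v,0)$. -}

module Defs where

open import Data.Bool.Base using (if_then_else_)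
open import Data.Fin.Base using (Fin; zero; suc; combine; quotient; remainder; opposite)
open import Data.Fin.Properties using (_≟_; all?; combine-injectiveˡ)
open import Data.Fin.Subset using (Subset; inside; outside; ∣_∣)
open import Data.Fin.Subset.Properties using (_∈?_)
open import Data.List.Base using (List; []; _∷_; _++_; map; filter; length; allFin)
open import Data.Nat.Base using (ℕ; zero; suc; _*_)
open import Data.Nat.Divisibility using (_∣_)
open import Data.Nat.ListAction using (sum)
import Data.Nat.Properties as ℕ
open import Data.Sum.Base using (_⊎_)
import Data.Vec.Base as Vec
open import Function.Base using (_∘_)
open import Level using (Level)
open import Relation.Binary.PropositionalEquality using (_≡_; _≢_)
open import Relation.Nullary.Decidable using (_⊎-dec_; _×-dec_)
open import Relation.Unary using (Pred; Decidable)

private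
  variable
    p : Level
    m : ℕ

-- Parallel edges are allowed; simple graphs are the case in which distinct
-- edges have distinct sets of ends. Edges are undirected: the order in which
-- the two ends are listed only serves as a reference for naming orientations.
record Graph : Set where
  field
    order    : ℕ
    size     : ℕ
    end₁     : Fin size → Fin order
    end₂     : Fin size → Fin order
    loopless : ∀ e → end₁ e ≢ end₂ e

  Vertex : Set
  Vertex = Fin order

  Edge : Set
  Edge = Fin size

open Graph public

#Fin : {P : Pred (Fin m) p} → Decidable P → ℕ
#Fin P? = length (filter P? (allFin _))

subsets : ∀ m → List (Subset m)
subsets zero    = Vec.[] ∷ []
subsets (suc m) = map (outside Vec.∷_) (subsets m) ++ map (inside Vec.∷_) (subsets m)

#Subset : {P : Pred (Subset m) p} → Decidable P → ℕ
#Subset P? = length (filter P? (subsets _))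

∑⊆ : (Subset m → ℕ) → ℕ
∑⊆ f = sum (map f (subsets _))

Incident : (G : Graph) → Vertex G → Edge G → Set
Incident G v e = end₁ G e ≡ v ⊎ end₂ G e ≡ v

incident? : (G : Graph) (v : Vertex G) → Decidable (Incident G v)
incident? G v e = (end₁ G e ≟ v) ⊎-dec (end₂ G e ≟ v)

degree : (G : Graph) → Vertex G → ℕ
degree G v = #Fin (incident? G v)

Eulerian : Graph → Set
Eulerian G = ∀ v → 2 ∣ degree G v

-- An orientation is recorded by the set of edges directed from end₁ to end₂;
-- the other edges are directed from end₂ to end₁. Since there are no loops,
-- the two directions of an edge are always different.
Orientation : Graph → Set
Orientation G = Subset (size G)

head tail : (G : Graph) → Orientation G → Edge G → Vertex G
head G o e = if Vec.lookup o e then end₂ G e else end₁ G e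
tail G o e = if Vec.lookup o e then end₁ G e else end₂ G e

indegree outdegree : (G : Graph) → Orientation G → Vertex G → ℕ
indegree  G o v = #Fin (λ e → head G o e ≟ v)
outdegree G o v = #Fin (λ e → tail G o e ≟ v)

IsEulerianOrientation : (G : Graph) → Orientation G → Set
IsEulerianOrientation G o = ∀ v → indegree G o v ≡ outdegree G o v

isEulerianOrientation? : (G : Graph) → Decidable (IsEulerianOrientation G)
isEulerianOrientation? G o = all? (λ v → indegree G o v ℕ.≟ outdegree G o v)

ε : Graph → ℕ
ε G = #Subset (isEulerianOrientation? G)

degreeIn : (G : Graph) → Subset (size G) → Vertex G → ℕ
degreeIn G S v = #Fin (λ e → (e ∈? S) ×-dec incident? G v e)

-- The requirement degreeIn G S v = degree G v / 2 is multiplied by 2, so that a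
-- graph with a vertex of odd degree has no half graph (truncating division
-- would wrongly admit some).
IsHalfGraph : (G : Graph) → Subset (size G) → Set
IsHalfGraph G S = ∀ v → 2 * degreeIn G S v ≡ degree G v

isHalfGraph? : (G : Graph) → Decidable (IsHalfGraph G)
isHalfGraph? G S = all? (λ v → 2 * degreeIn G S v ℕ.≟ degree G v)

h : Graph → ℕ
h G = #Subset (isHalfGraph? G)

-- The increasing enumeration of the elements of A.
element : (A : Subset m) → Fin ∣ A ∣ → Fin m
element (inside  Vec.∷ A) zero    = zero
element (inside  Vec.∷ A) (suc i) = suc (element A i)
element (outside Vec.∷ A) i       = suc (element A i)

-- The spanning subgraph (V , A).
_↾_ : (G : Graph) → Subset (size G) → Graph
G ↾ A = record
  { order    = order G
  ; size     = ∣ A ∣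
  ; end₁     = end₁ G ∘ element A
  ; end₂     = end₂ G ∘ element A
  ; loopless = loopless G ∘ element A
  }

-- V × {0,1} is encoded as Fin (order G * 2) by combine. Likewise, for an edge e
-- with ends u and v, combine e i is the edge (u , i)(v , 1 - i) for i = 0, 1.
_×K₂ : Graph → Graph
G ×K₂ = record
  { order    = order G * 2
  ; size     = size G * 2
  ; end₁     = λ e → combine (end₁ G (base e)) (layer e)
  ; end₂     = λ e → combine (end₂ G (base e)) (opposite (layer e))
  ; loopless = λ e eq → loopless G (base e)
      (combine-injectiveˡ (end₁ G (base e)) (layer e) (end₂ G (base e)) (opposite (layer e)) eq)
  }
  where
  base : Fin (size G * 2) → Edge G
  base = quotient 2

  layer : Fin (size G * 2) → Fin 2
  layer = remainder {size G} 2

{-# OPTIONS --safe #-}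
-- The sum: a set of edges of G × K₂ assigns two bits to every edge uv of G, one for each of
-- its copies. Let A be the set of edges whose bits differ, and orient uv ∈ A from u to v if
-- the copy (u,0)(v,1) is the one selected; on E ∖ A the common bit selects a set S. The degree
-- of (w,0) in the original set is then outdegree w + deg_S w and that of (w,1) is
-- indegree w + deg_S w, so that both are half of deg w exactly if the orientation is balanced
-- at w and S is a half graph at w.
--
-- The equality ε = h: for a bipartite graph, an orientation is the set of the edges directed
-- from layer 0 to layer 1.
module Submission where

open import Defs
import Algebra.Properties.CommutativeMonoid.Sum as Sum
import Algebra.Properties.CommutativeSemigroup as CommutativeSemigroup
open import Data.Bool.Base using (Bool; true; false; not; if_then_else_)
open import Data.Bool.Properties using (if-float)
open import Data.Empty using (⊥-elim)
open import Data.Fin.Base using (Fin; zero; suc; combine; opposite)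
open import Data.Fin.Properties using (_≟_; remQuot-combine; combine-injective; combine-surjective)
open import Data.Fin.Subset using (Subset; inside; outside; ∣_∣; ∁)
open import Data.Fin.Subset.Properties using (_∈?_)
open import Data.List.Base using (List; []; _∷_; map; filter; length; tabulate)
open import Data.List.Properties using (map-++; map-∘; map-cong)
open import Data.Nat.Base using (ℕ; zero; suc; _+_; _*_)
import Data.Nat.ListAction as List
open import Data.Nat.ListAction.Properties using (sum-++)
open import Data.Nat.Properties using (+-comm; +-assoc; +-identityʳ; +-cancelˡ-≡; +-cancelʳ-≡; *-cancelˡ-≡; *-distribˡ-+; *-distribʳ-+; *-zeroʳ; +-0-commutativeMonoid; +-commutativeSemigroup)
open import Data.Nat.Solver using (module +-*-Solver)
open import Data.Product.Base using (_×_; _,_; proj₁; proj₂)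
open import Data.Vec.Base using ([]; _∷_; lookup)
open import Function.Base using (_∘_; id)
open import Function.Bundles using (_⇔_; mk⇔)
open import Level using (Level)
open import Relation.Binary.PropositionalEquality using (_≡_; refl; sym; trans; cong; cong₂; module ≡-Reasoning)
open import Relation.Nullary.Decidable using (Dec; yes; no; does; does-⇔; _⊎-dec_; _×-dec_)
open import Relation.Nullary.Negation using (¬_)
open import Relation.Unary using (Pred; Decidable)

open ≡-Reasoning
open Sum +-0-commutativeMonoid using () renaming (sum to ∑; sum-cong-≗ to ∑-cong; ∑-distrib-+ to ∑-+)
open CommutativeSemigroup +-commutativeSemigroup using (interchange)

private
  variable
    a p q : Level
    X : Set a
    P : Set p
    Q : Set q
    m n : ℕ

-- Indicators

-- Only the bit `does P?` enters, so indicators of equivalent propositions agree even when their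
-- decision procedures differ.
𝟙 : Dec P → ℕ
𝟙 P? = if does P? then 1 else 0

𝟙-⇔ : P ⇔ Q → (P? : Dec P) (Q? : Dec Q) → 𝟙 P? ≡ 𝟙 Q?
𝟙-⇔ P⇔Q P? Q? = cong (if_then 1 else 0) (does-⇔ P⇔Q P? Q?)

𝟙-× : (P? : Dec P) (Q? : Dec Q) → 𝟙 (P? ×-dec Q?) ≡ 𝟙 P? * 𝟙 Q?
𝟙-× (yes _) Q? = sym (+-identityʳ _)
𝟙-× (no  _) Q? = refl

𝟙-⊎ : ¬ (P × Q) → (P? : Dec P) (Q? : Dec Q) → 𝟙 (P? ⊎-dec Q?) ≡ 𝟙 P? + 𝟙 Q?
𝟙-⊎ disjoint (yes p) (yes q) = ⊥-elim (disjoint (p , q))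
𝟙-⊎ disjoint (yes _) (no  _) = refl
𝟙-⊎ disjoint (no  _) Q?      = refl

length-filter : {P : Pred X p} (P? : Decidable P) (xs : List X) →
                length (filter P? xs) ≡ List.sum (map (𝟙 ∘ P?) xs)
length-filter P? []       = refl
length-filter P? (x ∷ xs) with does (P? x)
... | true  = cong suc (length-filter P? xs)
... | false = length-filter P? xs

sum-tabulate : (f : X → ℕ) (g : Fin m → X) → List.sum (map f (tabulate g)) ≡ ∑ (f ∘ g)
sum-tabulate {m = zero}  f g = refl
sum-tabulate {m = suc m} f g = cong (f (g zero) +_) (sum-tabulate f (g ∘ suc))

#Fin≡∑ : {P : Pred (Fin m) p} (P? : Decidable P) → #Fin P? ≡ ∑ (𝟙 ∘ P?)
#Fin≡∑ P? = trans (length-filter P? (tabulate id)) (sum-tabulate (𝟙 ∘ P?) id)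

#Subset≡∑⊆ : {P : Pred (Subset m) p} (P? : Decidable P) → #Subset P? ≡ ∑⊆ (𝟙 ∘ P?)
#Subset≡∑⊆ P? = length-filter P? (subsets _)

-- Sums over subsets

∑⊆-suc : (f : Subset (suc m) → ℕ) → ∑⊆ f ≡ ∑⊆ (f ∘ (outside ∷_)) + ∑⊆ (f ∘ (inside ∷_))
∑⊆-suc {m} f = begin
  ∑⊆ f
    ≡⟨ cong List.sum (map-++ f (map (outside ∷_) (subsets m)) _) ⟩
  _
    ≡⟨ sum-++ (map f (map (outside ∷_) (subsets m))) _ ⟩
  _
    ≡⟨ cong₂ (λ xs ys → List.sum xs + List.sum ys) (map-∘ (subsets m)) (map-∘ (subsets m)) ⟨
  ∑⊆ (f ∘ (outside ∷_)) + ∑⊆ (f ∘ (inside ∷_)) ∎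

∑⊆-cong : {f g : Subset m → ℕ} → (∀ A → f A ≡ g A) → ∑⊆ f ≡ ∑⊆ g
∑⊆-cong f≗g = cong List.sum (map-cong f≗g (subsets _))

∑⊆-+ : (f g : Subset m → ℕ) → ∑⊆ (λ A → f A + g A) ≡ ∑⊆ f + ∑⊆ g
∑⊆-+ {m} f g = go (subsets m)
  where
  go : ∀ xs → List.sum (map (λ A → f A + g A) xs) ≡ List.sum (map f xs) + List.sum (map g xs)
  go []       = refl
  go (A ∷ xs) = trans (cong (f A + g A +_) (go xs)) (interchange (f A) (g A) _ _)

∑⊆-*ˡ : ∀ k (f : Subset m → ℕ) → ∑⊆ (λ A → k * f A) ≡ k * ∑⊆ f
∑⊆-*ˡ {m} k f = go (subsets m)
  where
  go : ∀ xs → List.sum (map (λ A → k * f A) xs) ≡ k * List.sum (map f xs)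
  go []       = sym (*-zeroʳ k)
  go (A ∷ xs) = trans (cong (k * f A +_) (go xs)) (sym (*-distribˡ-+ k (f A) _))

∑⊆-*ʳ : ∀ k (f : Subset m → ℕ) → ∑⊆ (λ A → f A * k) ≡ ∑⊆ f * k
∑⊆-*ʳ {m} k f = go (subsets m)
  where
  go : ∀ xs → List.sum (map (λ A → f A * k) xs) ≡ List.sum (map f xs) * k
  go []       = refl
  go (A ∷ xs) = trans (cong (f A * k +_) (go xs)) (sym (*-distribʳ-+ k (f A) _))

∑⊆-* : (f : Subset m → ℕ) (g : Subset n → ℕ) → ∑⊆ (λ A → ∑⊆ (λ B → f A * g B)) ≡ ∑⊆ f * ∑⊆ g
∑⊆-* f g = trans (∑⊆-cong (λ A → ∑⊆-*ˡ (f A) g)) (∑⊆-*ʳ (∑⊆ g) f)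

-- Sets of edges of the double cover

merge : (A : Subset m) → Subset ∣ A ∣ → Subset ∣ ∁ A ∣ → Subset (m * 2)
merge []            o       S       = []
merge (inside  ∷ A) (b ∷ o) S       = b ∷ not b ∷ merge A o S
merge (outside ∷ A) o       (b ∷ S) = b ∷ b ∷ merge A o S

-- This is the bijectivity of `merge` in the form of a change of variables. The first two bits take
-- four values: the two with equal bits belong to a first edge outside `A`, the two with different
-- bits to a first edge in `A`.
∑⊆-merge : ∀ m (f : Subset (m * 2) → ℕ) →
           ∑⊆ f ≡ ∑⊆ (λ (A : Subset m) → ∑⊆ (λ o → ∑⊆ (λ S → f (merge A o S))))
∑⊆-merge zero    f = cong (_+ 0) (sym (trans (+-identityʳ _) (+-identityʳ _)))
∑⊆-merge (suc m) f = begin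
  ∑⊆ f
    ≡⟨ ∑⊆-suc f ⟩
  ∑⊆ (λ s → f (outside ∷ s)) + ∑⊆ (λ s → f (inside ∷ s))
    ≡⟨ cong₂ _+_ (∑⊆-suc (λ s → f (outside ∷ s))) (∑⊆-suc (λ s → f (inside ∷ s))) ⟩
  (∑⊆ (f² outside outside) + ∑⊆ (f² outside inside)) + (∑⊆ (f² inside outside) + ∑⊆ (f² inside inside))
    ≡⟨ cong₂ _+_ (cong₂ _+_ (IH outside outside) (IH outside inside))
                 (cong₂ _+_ (IH inside outside) (IH inside inside)) ⟩
  (T outside outside + T outside inside) + (T inside outside + T inside inside)
    -- Regroups the four values of the bit pair into equal pairs and different pairs.
    ≡⟨ solve 4 (λ w x y z → (w :+ x) :+ (y :+ z) := (w :+ z) :+ (x :+ y)) refl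
         (T outside outside) (T outside inside) (T inside outside) (T inside inside) ⟩
  (T outside outside + T inside inside) + (T outside inside + T inside outside)
    ≡⟨ cong₂ _+_ agree differ ⟨
  ∑⊆ (λ A → F (outside ∷ A)) + ∑⊆ (λ A → F (inside ∷ A))
    ≡⟨ ∑⊆-suc F ⟨
  ∑⊆ F ∎
  where
  open +-*-Solver

  f² : Bool → Bool → Subset (m * 2) → ℕ
  f² x y s = f (x ∷ y ∷ s)

  g : Bool → Bool → (A : Subset m) → Subset ∣ A ∣ → ℕ
  g x y A o = ∑⊆ (λ S → f² x y (merge A o S))

  T : Bool → Bool → ℕ
  T x y = ∑⊆ (λ A → ∑⊆ (g x y A))

  F : Subset (suc m) → ℕ
  F A = ∑⊆ (λ o → ∑⊆ (λ S → f (merge A o S)))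

  IH : ∀ x y → ∑⊆ (f² x y) ≡ T x y
  IH x y = ∑⊆-merge m (f² x y)

  -- Here the common bit is the head of `S`, so the innermost sum splits and the splitting is
  -- carried out through two outer sums. In `differ` the bit is the head of `o`, and only the sum
  -- over `A` remains outside.
  agree : ∑⊆ (λ A → F (outside ∷ A)) ≡ T outside outside + T inside inside
  agree = trans
    (∑⊆-cong λ (A : Subset m) → trans
      (∑⊆-cong λ o → ∑⊆-suc (λ S → f (merge (outside ∷ A) o S)))
      (∑⊆-+ (g outside outside A) (g inside inside A)))
    (∑⊆-+ (λ A → ∑⊆ (g outside outside A)) (λ A → ∑⊆ (g inside inside A)))

  differ : ∑⊆ (λ A → F (inside ∷ A)) ≡ T outside inside + T inside outside
  differ = trans
    (∑⊆-cong λ (A : Subset m) → ∑⊆-suc (λ o → ∑⊆ (λ S → f (merge (inside ∷ A) o S))))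
    (∑⊆-+ (λ A → ∑⊆ (g outside inside A)) (λ A → ∑⊆ (g inside outside A)))

-- The set of edges directed from layer 0 to layer 1: the copy combine e 1 of e has its first end
-- in layer 1, so its bit is flipped.
twist : ∀ m → Subset (m * 2) → Subset (m * 2)
twist zero    []          = []
twist (suc m) (x ∷ y ∷ s) = x ∷ not y ∷ twist m s

-- Flipping a fixed set of bits permutes the subsets. In the induction, flipping the second bit
-- merely exchanges two summands.
∑⊆-twist : ∀ m (f : Subset (m * 2) → ℕ) → ∑⊆ (f ∘ twist m) ≡ ∑⊆ f
∑⊆-twist zero    f = refl
∑⊆-twist (suc m) f = begin
  ∑⊆ (f ∘ twist (suc m))
    ≡⟨ ∑⊆-suc (f ∘ twist (suc m)) ⟩
  _
    ≡⟨ cong₂ _+_ (half outside) (half inside) ⟩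
  ∑⊆ (λ s → f (outside ∷ s)) + ∑⊆ (λ s → f (inside ∷ s))
    ≡⟨ ∑⊆-suc f ⟨
  ∑⊆ f ∎
  where
  half : ∀ x → ∑⊆ (λ s → f (twist (suc m) (x ∷ s))) ≡ ∑⊆ (λ s → f (x ∷ s))
  half x = begin
    ∑⊆ (λ s → f (twist (suc m) (x ∷ s)))
      ≡⟨ ∑⊆-suc (λ s → f (twist (suc m) (x ∷ s))) ⟩
    -- The summand for the bit `outside` comes first, and `not` has turned that bit into `inside`.
    ∑⊆ (λ s → f (x ∷ inside ∷ twist m s)) + ∑⊆ (λ s → f (x ∷ outside ∷ twist m s))
      ≡⟨ cong₂ _+_ (∑⊆-twist m (λ s → f (x ∷ inside ∷ s))) (∑⊆-twist m (λ s → f (x ∷ outside ∷ s))) ⟩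
    ∑⊆ (λ s → f (x ∷ inside ∷ s)) + ∑⊆ (λ s → f (x ∷ outside ∷ s))
      ≡⟨ +-comm (∑⊆ (λ s → f (x ∷ inside ∷ s))) _ ⟩
    ∑⊆ (λ s → f (x ∷ outside ∷ s)) + ∑⊆ (λ s → f (x ∷ inside ∷ s))
      ≡⟨ ∑⊆-suc (λ s → f (x ∷ s)) ⟨
    ∑⊆ (λ s → f (x ∷ s)) ∎

pattern 0F = zero
pattern 1F = suc zero

lookup-twist-0F : ∀ (s : Subset (m * 2)) (e : Fin m) →
                  lookup (twist m s) (combine e 0F) ≡ lookup s (combine e 0F)
lookup-twist-0F (x ∷ y ∷ s) zero    = refl
lookup-twist-0F (x ∷ y ∷ s) (suc e) = lookup-twist-0F s e

lookup-twist-1F : ∀ (s : Subset (m * 2)) (e : Fin m) →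
                  lookup (twist m s) (combine e 1F) ≡ not (lookup s (combine e 1F))
lookup-twist-1F (x ∷ y ∷ s) zero    = refl
lookup-twist-1F (x ∷ y ∷ s) (suc e) = lookup-twist-1F s e

-- Sums over edges

∑-*2 : ∀ m (f : Fin (m * 2) → ℕ) → ∑ f ≡ ∑ (λ (e : Fin m) → f (combine e 0F) + f (combine e 1F))
∑-*2 zero    f = refl
∑-*2 (suc m) f = trans (sym (+-assoc (f 0F) (f 1F) _))
  (cong (f 0F + f 1F +_) (∑-*2 m (λ e → f (suc (suc e)))))

∑-element : (A : Subset m) (f : Fin m → ℕ) → ∑ f ≡ ∑ (f ∘ element A) + ∑ (f ∘ element (∁ A))
∑-element []            f = refl
∑-element (inside  ∷ A) f = trans (cong (f zero +_) (∑-element A (f ∘ suc))) (sym (+-assoc (f zero) _ _))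
∑-element (outside ∷ A) f = begin
  f zero + ∑ (f ∘ suc)  ≡⟨ cong (f zero +_) (∑-element A (f ∘ suc)) ⟩
  f zero + (x + y)      ≡⟨ solve 3 (λ c x y → c :+ (x :+ y) := x :+ (c :+ y)) refl (f zero) x y ⟩
  x + (f zero + y)      ∎
  where
  open +-*-Solver
  x = ∑ (f ∘ suc ∘ element A)
  y = ∑ (f ∘ suc ∘ element (∁ A))

∑∈ : Subset m → (Fin m → ℕ) → ℕ
∑∈ S f = ∑ (λ e → if lookup S e then f e else 0)

∑∈-cong : (S : Subset m) {f g : Fin m → ℕ} → (∀ e → f e ≡ g e) → ∑∈ S f ≡ ∑∈ S g
∑∈-cong S f≗g = ∑-cong λ e → cong (if lookup S e then_else 0) (f≗g e)

-- An edge of `A` has exactly one selected copy, and `o` says which; any other edge has both copies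
-- selected or neither, according to `S`.
∑∈-merge : (A : Subset m) (o : Subset ∣ A ∣) (S : Subset ∣ ∁ A ∣) (f : Fin (m * 2) → ℕ) →
  ∑∈ (merge A o S) f ≡
    ∑ (λ i → if lookup o i then f (combine (element A i) 0F) else f (combine (element A i) 1F)) +
    ∑∈ S (λ i → f (combine (element (∁ A) i) 0F) + f (combine (element (∁ A) i) 1F))
∑∈-merge []            o       S       f = refl
∑∈-merge (inside  ∷ A) (b ∷ o) S       f with ∑∈-merge A o S (λ e → f (suc (suc e))) | b
... | IH | true  = trans (cong (f 0F +_) IH) (sym (+-assoc (f 0F) _ _))
... | IH | false = trans (cong (f 1F +_) IH) (sym (+-assoc (f 1F) _ _))
∑∈-merge (outside ∷ A) o       (b ∷ S) f with ∑∈-merge A o S (λ e → f (suc (suc e))) | b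
... | IH | true  = trans (cong (λ s → f 0F + (f 1F + s)) IH)
  (solve 4 (λ c d x y → c :+ (d :+ (x :+ y)) := x :+ (c :+ d :+ y)) refl (f 0F) (f 1F) x y)
  where
  open +-*-Solver
  x = ∑ (λ i → if lookup o i then f (suc (suc (combine (element A i) 0F))) else f (suc (suc (combine (element A i) 1F))))
  y = ∑∈ S (λ i → f (suc (suc (combine (element (∁ A) i) 0F))) + f (suc (suc (combine (element (∁ A) i) 1F))))
... | IH | false = IH

does-∈? : (S : Subset m) (e : Fin m) → does (e ∈? S) ≡ lookup S e
does-∈? (inside  ∷ S) zero    = refl
does-∈? (outside ∷ S) zero    = refl
does-∈? (x       ∷ S) (suc e) = does-∈? S e

-- Degrees

δ : Fin m → Fin m → ℕ
δ x y = 𝟙 (x ≟ y)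

δ-combine : ∀ (u w : Fin m) (j i : Fin n) →
            δ (combine u j) (combine w i) ≡ (if does (j ≟ i) then δ u w else 0)
δ-combine u w j i with j ≟ i
... | yes refl = 𝟙-⇔ (mk⇔ (proj₁ ∘ combine-injective u j w j) (cong (λ x → combine x j))) (combine u j ≟ combine w j) (u ≟ w)
... | no  j≢i  with combine u j ≟ combine w i
...   | yes eq = ⊥-elim (j≢i (proj₂ (combine-injective u j w i eq)))
...   | no  _  = refl

-- Without loops the two ends cannot both be `v`, so the disjunction becomes a sum. All degree
-- computations below rest on this additive form.
𝟙-incident : ∀ G v e → 𝟙 (incident? G v e) ≡ δ (end₁ G e) v + δ (end₂ G e) v
𝟙-incident G v e = 𝟙-⊎ (λ (eq₁ , eq₂) → loopless G e (trans eq₁ (sym eq₂))) (end₁ G e ≟ v) (end₂ G e ≟ v)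

degree≡∑ : ∀ G v → degree G v ≡ ∑ (λ e → δ (end₁ G e) v + δ (end₂ G e) v)
degree≡∑ G v = trans (#Fin≡∑ (incident? G v)) (∑-cong (𝟙-incident G v))

degreeIn≡∑∈ : ∀ G S v → degreeIn G S v ≡ ∑∈ S (λ e → δ (end₁ G e) v + δ (end₂ G e) v)
degreeIn≡∑∈ G S v = trans (#Fin≡∑ (λ e → (e ∈? S) ×-dec incident? G v e)) (∑-cong λ e → begin
  𝟙 ((e ∈? S) ×-dec incident? G v e)
    ≡⟨ 𝟙-× (e ∈? S) (incident? G v e) ⟩
  (if does (e ∈? S) then 1 else 0) * 𝟙 (incident? G v e)
    ≡⟨ cong₂ (λ b k → (if b then 1 else 0) * k) (does-∈? S e) (𝟙-incident G v e) ⟩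
  (if lookup S e then 1 else 0) * (δ (end₁ G e) v + δ (end₂ G e) v)
    ≡⟨ if-* (lookup S e) _ ⟩
  (if lookup S e then δ (end₁ G e) v + δ (end₂ G e) v else 0) ∎)
  where
  if-* : ∀ b k → (if b then 1 else 0) * k ≡ (if b then k else 0)
  if-* true  k = +-identityʳ k
  if-* false k = refl

outdegree≡∑ : ∀ G o v → outdegree G o v ≡ ∑ (λ e → if lookup o e then δ (end₁ G e) v else δ (end₂ G e) v)
outdegree≡∑ G o v = trans (#Fin≡∑ (λ e → tail G o e ≟ v))
  (∑-cong λ e → if-float (λ x → δ x v) (lookup o e))

indegree≡∑ : ∀ G o v → indegree G o v ≡ ∑ (λ e → if lookup o e then δ (end₂ G e) v else δ (end₁ G e) v)
indegree≡∑ G o v = trans (#Fin≡∑ (λ e → head G o e ≟ v))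
  (∑-cong λ e → if-float (λ x → δ x v) (lookup o e))

-- Whatever its direction, an edge has one of its two ends as head and the other as tail.
degree≡indegree+outdegree : ∀ G o v → degree G v ≡ indegree G o v + outdegree G o v
degree≡indegree+outdegree G o v = begin
  degree G v
    ≡⟨ degree≡∑ G v ⟩
  _
    ≡⟨ ∑-cong (λ e → if-both (lookup o e)) ⟩
  _
    ≡⟨ ∑-+ (λ e → if lookup o e then δ (end₂ G e) v else δ (end₁ G e) v) _ ⟩
  _
    ≡⟨ cong₂ _+_ (indegree≡∑ G o v) (outdegree≡∑ G o v) ⟨
  indegree G o v + outdegree G o v ∎
  where
  if-both : ∀ b {x y} → x + y ≡ (if b then y else x) + (if b then x else y)
  if-both true  {x} {y} = +-comm x y
  if-both false         = refl

degree-↾ : ∀ G A v → degree G v ≡ degree (G ↾ A) v + degree (G ↾ ∁ A) v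
degree-↾ G A v = begin
  degree G v
    ≡⟨ degree≡∑ G v ⟩
  _
    ≡⟨ ∑-element A _ ⟩
  _
    ≡⟨ cong₂ _+_ (degree≡∑ (G ↾ A) v) (degree≡∑ (G ↾ ∁ A) v) ⟨
  degree (G ↾ A) v + degree (G ↾ ∁ A) v ∎

-- Degrees in the double cover

module _ (G : Graph) where

  δ-end₁ : ∀ w i e j → δ (end₁ (G ×K₂) (combine e j)) (combine w i) ≡ (if does (j ≟ i) then δ (end₁ G e) w else 0)
  δ-end₁ w i e j = trans
    -- The base edge and the layer are the two components of `remQuot`, so a single rewriting
    -- recovers both.
    (cong (λ (e , j) → δ (combine (end₁ G e) j) (combine w i)) (remQuot-combine e j))
    (δ-combine (end₁ G e) w j i)

  δ-end₂ : ∀ w i e j → δ (end₂ (G ×K₂) (combine e j)) (combine w i) ≡ (if does (opposite j ≟ i) then δ (end₂ G e) w else 0)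
  δ-end₂ w i e j = trans
    (cong (λ (e , j) → δ (combine (end₂ G e) (opposite j)) (combine w i)) (remQuot-combine e j))
    (δ-combine (end₂ G e) w (opposite j) i)

  incidence : Vertex (G ×K₂) → Edge (G ×K₂) → ℕ
  incidence v e = δ (end₁ (G ×K₂) e) v + δ (end₂ (G ×K₂) e) v

  -- The copy `combine e i` has only its first end in layer `i`, while the opposite copy has only
  -- its second end there. Hence one of the two terms always vanishes; splitting on `i` makes the
  -- comparison of layers compute.
  incidence-near : ∀ w i e → incidence (combine w i) (combine e i) ≡ δ (end₁ G e) w
  incidence-near w 0F e = trans (cong₂ _+_ (δ-end₁ w 0F e 0F) (δ-end₂ w 0F e 0F)) (+-identityʳ _)
  incidence-near w 1F e = trans (cong₂ _+_ (δ-end₁ w 1F e 1F) (δ-end₂ w 1F e 1F)) (+-identityʳ _)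

  incidence-far : ∀ w i e → incidence (combine w i) (combine e (opposite i)) ≡ δ (end₂ G e) w
  incidence-far w 0F e = cong₂ _+_ (δ-end₁ w 0F e 1F) (δ-end₂ w 0F e 1F)
  incidence-far w 1F e = cong₂ _+_ (δ-end₁ w 1F e 0F) (δ-end₂ w 1F e 0F)

  -- Each edge at `w` has exactly one copy at the vertex over `w` in layer `i`: the near copy if `w`
  -- is its first end, the far copy if `w` is its second end.
  degree-×K₂ : ∀ w i → degree (G ×K₂) (combine w i) ≡ degree G w
  degree-×K₂ w i = begin
    degree (G ×K₂) (combine w i)
      ≡⟨ degree≡∑ (G ×K₂) (combine w i) ⟩
    ∑ (incidence (combine w i))
      ≡⟨ ∑-*2 (size G) _ ⟩
    ∑ (λ (e : Edge G) → incidence (combine w i) (combine e 0F) + incidence (combine w i) (combine e 1F))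
      ≡⟨ ∑-cong (copies i) ⟩
    ∑ (λ e → δ (end₁ G e) w + δ (end₂ G e) w)
      ≡⟨ degree≡∑ G w ⟨
    degree G w ∎
    where
    copies : ∀ i e → incidence (combine w i) (combine e 0F) + incidence (combine w i) (combine e 1F)
                     ≡ δ (end₁ G e) w + δ (end₂ G e) w
    copies 0F e = cong₂ _+_ (incidence-near w 0F e) (incidence-far w 0F e)
    copies 1F e = trans (cong₂ _+_ (incidence-far w 1F e) (incidence-near w 1F e)) (+-comm (δ (end₂ G e) w) _)

  -- Half graphs of the double cover and the sum over edge sets

  module _ (A : Subset (size G)) (o : Orientation (G ↾ A)) (S : Subset ∣ ∁ A ∣) where

    -- The selected copy of an edge of `A` has the tail of that edge as its end in layer 0. An edge
    -- selected by `S` contributes both copies, hence both of its ends.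
    degreeIn-merge-0F : ∀ w → degreeIn (G ×K₂) (merge A o S) (combine w 0F) ≡ outdegree (G ↾ A) o w + degreeIn (G ↾ ∁ A) S w
    degreeIn-merge-0F w = begin
      degreeIn (G ×K₂) (merge A o S) (combine w 0F)
        ≡⟨ degreeIn≡∑∈ (G ×K₂) (merge A o S) (combine w 0F) ⟩
      ∑∈ (merge A o S) (incidence (combine w 0F))
        ≡⟨ ∑∈-merge A o S _ ⟩
      _
        ≡⟨ cong₂ _+_
             (∑-cong λ i → cong₂ (if lookup o i then_else_) (incidence-near w 0F _) (incidence-far w 0F _))
             (∑∈-cong S λ i → cong₂ _+_ (incidence-near w 0F _) (incidence-far w 0F _)) ⟩
      _
        ≡⟨ cong₂ _+_ (outdegree≡∑ (G ↾ A) o w) (degreeIn≡∑∈ (G ↾ ∁ A) S w) ⟨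
      outdegree (G ↾ A) o w + degreeIn (G ↾ ∁ A) S w ∎

    -- In layer 1 near and far copies exchange roles, so the end of the selected copy is now the
    -- head.
    degreeIn-merge-1F : ∀ w → degreeIn (G ×K₂) (merge A o S) (combine w 1F) ≡ indegree (G ↾ A) o w + degreeIn (G ↾ ∁ A) S w
    degreeIn-merge-1F w = begin
      degreeIn (G ×K₂) (merge A o S) (combine w 1F)
        ≡⟨ degreeIn≡∑∈ (G ×K₂) (merge A o S) (combine w 1F) ⟩
      ∑∈ (merge A o S) (incidence (combine w 1F))
        ≡⟨ ∑∈-merge A o S _ ⟩
      _
        ≡⟨ cong₂ _+_
             (∑-cong λ i → cong₂ (if lookup o i then_else_) (incidence-far w 1F _) (incidence-near w 1F _))
             (∑∈-cong S λ i → trans (cong₂ _+_ (incidence-far w 1F _) (incidence-near w 1F _))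
                                    (+-comm (δ (end₂ G (element (∁ A) i)) w) _)) ⟩
      _
        ≡⟨ cong₂ _+_ (indegree≡∑ (G ↾ A) o w) (degreeIn≡∑∈ (G ↾ ∁ A) S w) ⟨
      indegree (G ↾ A) o w + degreeIn (G ↾ ∁ A) S w ∎

    -- Write s for the degree in `S` and d for the degree in `G ↾ ∁ A`. The two vertices over `w`
    -- give 2(out + s) = in + out + d and 2(in + s) = in + out + d. Comparing them yields in = out,
    -- and then 2s = d; conversely, these two imply both equations.
    halfGraph-merge : IsHalfGraph (G ×K₂) (merge A o S) ⇔ (IsEulerianOrientation (G ↾ A) o × IsHalfGraph (G ↾ ∁ A) S)
    halfGraph-merge = mk⇔
      (λ half → (λ w → balanced w half) , (λ w → halved w half))
      (λ (eulerian , half) v → covered eulerian half v)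
      where
      deg : ∀ w i → degree (G ×K₂) (combine w i) ≡ indegree (G ↾ A) o w + outdegree (G ↾ A) o w + degree (G ↾ ∁ A) w
      deg w i = trans (degree-×K₂ w i)
        (trans (degree-↾ G A w) (cong (_+ degree (G ↾ ∁ A) w) (degree≡indegree+outdegree (G ↾ A) o w)))

      double : ∀ x k → 2 * (x + k) ≡ x + x + 2 * k
      double = solve 2 (λ x k → con 2 :* (x :+ k) := x :+ x :+ con 2 :* k) refl
        where open +-*-Solver

      balanced : ∀ w → IsHalfGraph (G ×K₂) (merge A o S) → indegree (G ↾ A) o w ≡ outdegree (G ↾ A) o w
      balanced w half = +-cancelʳ-≡ (degreeIn (G ↾ ∁ A) S w) _ _ (*-cancelˡ-≡ _ _ 2 (begin
        2 * (indegree (G ↾ A) o w + degreeIn (G ↾ ∁ A) S w)   ≡⟨ cong (2 *_) (degreeIn-merge-1F w) ⟨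
        2 * degreeIn (G ×K₂) (merge A o S) (combine w 1F)     ≡⟨ half (combine w 1F) ⟩
        degree (G ×K₂) (combine w 1F)                         ≡⟨ degree-×K₂ w 1F ⟩
        degree G w                                            ≡⟨ degree-×K₂ w 0F ⟨
        degree (G ×K₂) (combine w 0F)                         ≡⟨ half (combine w 0F) ⟨
        2 * degreeIn (G ×K₂) (merge A o S) (combine w 0F)     ≡⟨ cong (2 *_) (degreeIn-merge-0F w) ⟩
        2 * (outdegree (G ↾ A) o w + degreeIn (G ↾ ∁ A) S w)  ∎))

      halved : ∀ w → IsHalfGraph (G ×K₂) (merge A o S) → 2 * degreeIn (G ↾ ∁ A) S w ≡ degree (G ↾ ∁ A) w
      halved w half = +-cancelˡ-≡ (out + out) _ _ (begin
        out + out + 2 * degreeIn (G ↾ ∁ A) S w                       ≡⟨ double out _ ⟨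
        2 * (out + degreeIn (G ↾ ∁ A) S w)                           ≡⟨ cong (2 *_) (degreeIn-merge-0F w) ⟨
        2 * degreeIn (G ×K₂) (merge A o S) (combine w 0F)            ≡⟨ half (combine w 0F) ⟩
        degree (G ×K₂) (combine w 0F)                                ≡⟨ deg w 0F ⟩
        indegree (G ↾ A) o w + out + degree (G ↾ ∁ A) w              ≡⟨ cong (λ x → x + out + degree (G ↾ ∁ A) w) (balanced w half) ⟩
        out + out + degree (G ↾ ∁ A) w                               ∎)
        where out = outdegree (G ↾ A) o w

      covered : IsEulerianOrientation (G ↾ A) o → IsHalfGraph (G ↾ ∁ A) S → IsHalfGraph (G ×K₂) (merge A o S)
      covered eulerian half v with combine-surjective {order G} {2} v
      ... | w , i , refl = begin
        2 * degreeIn (G ×K₂) (merge A o S) (combine w i)   ≡⟨ cong (2 *_) (degreeIn-merge i) ⟩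
        2 * (out + degreeIn (G ↾ ∁ A) S w)                 ≡⟨ double out _ ⟩
        out + out + 2 * degreeIn (G ↾ ∁ A) S w             ≡⟨ cong₂ (λ x y → x + out + y) (sym (eulerian w)) (half w) ⟩
        indegree (G ↾ A) o w + out + degree (G ↾ ∁ A) w    ≡⟨ deg w i ⟨
        degree (G ×K₂) (combine w i)                       ∎
        where
        out = outdegree (G ↾ A) o w

        -- In layer 1 the indegree appears, and balance replaces it by the outdegree, so one
        -- calculation serves both layers.
        degreeIn-merge : ∀ i → degreeIn (G ×K₂) (merge A o S) (combine w i) ≡ out + degreeIn (G ↾ ∁ A) S w
        degreeIn-merge 0F = degreeIn-merge-0F w
        degreeIn-merge 1F = trans (degreeIn-merge-1F w) (cong (_+ degreeIn (G ↾ ∁ A) S w) (eulerian w))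

  h-×K₂ : h (G ×K₂) ≡ ∑⊆ (λ A → ε (G ↾ A) * h (G ↾ ∁ A))
  h-×K₂ = begin
    h (G ×K₂)
      ≡⟨ #Subset≡∑⊆ (isHalfGraph? (G ×K₂)) ⟩
    ∑⊆ (𝟙 ∘ isHalfGraph? (G ×K₂))
      ≡⟨ ∑⊆-merge (size G) _ ⟩
    ∑⊆ (λ (A : Subset (size G)) → ∑⊆ (λ o → ∑⊆ (λ S → 𝟙 (isHalfGraph? (G ×K₂) (merge A o S)))))
      ≡⟨ (∑⊆-cong λ A → ∑⊆-cong λ o → ∑⊆-cong λ S → trans
            (𝟙-⇔ (halfGraph-merge A o S) (isHalfGraph? (G ×K₂) (merge A o S)) (isEulerianOrientation? (G ↾ A) o ×-dec isHalfGraph? (G ↾ ∁ A) S))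
            (𝟙-× (isEulerianOrientation? (G ↾ A) o) (isHalfGraph? (G ↾ ∁ A) S))) ⟩
    ∑⊆ (λ A → ∑⊆ (λ o → ∑⊆ (λ S → 𝟙 (isEulerianOrientation? (G ↾ A) o) * 𝟙 (isHalfGraph? (G ↾ ∁ A) S))))
      -- For fixed `A` the choices of `o` and `S` are independent, so the double sum is a product of
      -- two counts.
      ≡⟨ (∑⊆-cong λ A → trans
            (∑⊆-* (𝟙 ∘ isEulerianOrientation? (G ↾ A)) (𝟙 ∘ isHalfGraph? (G ↾ ∁ A)))
            (sym (cong₂ _*_ (#Subset≡∑⊆ (isEulerianOrientation? (G ↾ A))) (#Subset≡∑⊆ (isHalfGraph? (G ↾ ∁ A)))))) ⟩
    ∑⊆ (λ A → ε (G ↾ A) * h (G ↾ ∁ A)) ∎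

  -- Eulerian orientations of the double cover as half graphs

  module _ (o : Orientation (G ×K₂)) where

    private
      -- In a fixed layer one end of each edge contributes 0. That vanishing term can stand in for
      -- the default 0, which turns the contribution of a selected edge into that of a tail or head.
      -- The negated variant serves the copies whose bit `twist` flips.
      only-if : ∀ b {x y} → y ≡ 0 → (if b then x + y else 0) ≡ (if b then x else y)
      only-if true  refl = +-identityʳ _
      only-if false refl = refl

      only-if-not : ∀ b {x y} → x ≡ 0 → (if not b then x + y else 0) ≡ (if b then x else y)
      only-if-not true  refl = refl
      only-if-not false refl = refl

    -- The selected edges are those directed from layer 0 to layer 1, so at a vertex of layer 0 they
    -- are the outgoing ones and at a vertex of layer 1 the incoming ones.
    degreeIn-twist-0F : ∀ w → degreeIn (G ×K₂) (twist (size G) o) (combine w 0F) ≡ outdegree (G ×K₂) o (combine w 0F)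
    degreeIn-twist-0F w = begin
      degreeIn (G ×K₂) (twist (size G) o) (combine w 0F)
        ≡⟨ degreeIn≡∑∈ (G ×K₂) (twist (size G) o) (combine w 0F) ⟩
      ∑∈ (twist (size G) o) (incidence (combine w 0F))
        ≡⟨ ∑-*2 (size G) _ ⟩
      _
        ≡⟨ (∑-cong λ e → cong₂ _+_
             (trans (cong (if_then _ else 0) (lookup-twist-0F o e)) (only-if (lookup o (combine e 0F)) (δ-end₂ w 0F e 0F)))
             (trans (cong (if_then _ else 0) (lookup-twist-1F o e)) (only-if-not (lookup o (combine e 1F)) (δ-end₁ w 0F e 1F)))) ⟩
      _
        ≡⟨ ∑-*2 (size G) _ ⟨
      _
        ≡⟨ outdegree≡∑ (G ×K₂) o (combine w 0F) ⟨
      outdegree (G ×K₂) o (combine w 0F) ∎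

    degreeIn-twist-1F : ∀ w → degreeIn (G ×K₂) (twist (size G) o) (combine w 1F) ≡ indegree (G ×K₂) o (combine w 1F)
    degreeIn-twist-1F w = begin
      degreeIn (G ×K₂) (twist (size G) o) (combine w 1F)
        ≡⟨ degreeIn≡∑∈ (G ×K₂) (twist (size G) o) (combine w 1F) ⟩
      ∑∈ (twist (size G) o) (incidence (combine w 1F))
        -- Heads list the ends in the opposite order from tails; after the exchange the vanishing
        -- term is where `only-if` and `only-if-not` expect it.
        ≡⟨ (∑∈-cong (twist (size G) o) λ e → +-comm (δ (end₁ (G ×K₂) e) (combine w 1F)) _) ⟩
      _
        ≡⟨ ∑-*2 (size G) _ ⟩
      _
        ≡⟨ (∑-cong λ e → cong₂ _+_
             (trans (cong (if_then _ else 0) (lookup-twist-0F o e)) (only-if (lookup o (combine e 0F)) (δ-end₁ w 1F e 0F)))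
             (trans (cong (if_then _ else 0) (lookup-twist-1F o e)) (only-if-not (lookup o (combine e 1F)) (δ-end₂ w 1F e 1F)))) ⟩
      _
        ≡⟨ ∑-*2 (size G) _ ⟨
      _
        ≡⟨ indegree≡∑ (G ×K₂) o (combine w 1F) ⟨
      indegree (G ×K₂) o (combine w 1F) ∎

    -- As the degree is in + out, the half graph condition reads 2 out = in + out in layer 0 and 2
    -- in = in + out in layer 1. Each is equivalent to in = out.
    halfGraph-twist : IsEulerianOrientation (G ×K₂) o ⇔ IsHalfGraph (G ×K₂) (twist (size G) o)
    halfGraph-twist = mk⇔ to from
      where
      double : ∀ x → 2 * x ≡ x + x
      double x = cong (x +_) (+-identityʳ x)

      to : IsEulerianOrientation (G ×K₂) o → IsHalfGraph (G ×K₂) (twist (size G) o)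
      to eulerian v with combine-surjective {order G} {2} v
      ... | w , i , refl = begin
        2 * degreeIn (G ×K₂) (twist (size G) o) v           ≡⟨ cong (2 *_) (degreeIn-twist i) ⟩
        2 * outdegree (G ×K₂) o v                           ≡⟨ double (outdegree (G ×K₂) o v) ⟩
        outdegree (G ×K₂) o v + outdegree (G ×K₂) o v       ≡⟨ cong (_+ outdegree (G ×K₂) o v) (eulerian v) ⟨
        indegree (G ×K₂) o v + outdegree (G ×K₂) o v        ≡⟨ degree≡indegree+outdegree (G ×K₂) o v ⟨
        degree (G ×K₂) v                                    ∎
        where
        degreeIn-twist : ∀ i → degreeIn (G ×K₂) (twist (size G) o) (combine w i) ≡ outdegree (G ×K₂) o (combine w i)
        degreeIn-twist 0F = degreeIn-twist-0F w
        degreeIn-twist 1F = trans (degreeIn-twist-1F w) (eulerian (combine w 1F))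

      from : IsHalfGraph (G ×K₂) (twist (size G) o) → IsEulerianOrientation (G ×K₂) o
      from half v with combine-surjective {order G} {2} v
      -- The layers are treated separately because the term to cancel is the outdegree in layer 0
      -- and the indegree in layer 1.
      ... | w , 0F , refl = sym (+-cancelʳ-≡ (outdegree (G ×K₂) o v) _ _ (begin
        outdegree (G ×K₂) o v + outdegree (G ×K₂) o v  ≡⟨ double (outdegree (G ×K₂) o v) ⟨
        2 * outdegree (G ×K₂) o v                      ≡⟨ cong (2 *_) (degreeIn-twist-0F w) ⟨
        2 * degreeIn (G ×K₂) (twist (size G) o) v      ≡⟨ half v ⟩
        degree (G ×K₂) v                               ≡⟨ degree≡indegree+outdegree (G ×K₂) o v ⟩
        indegree (G ×K₂) o v + outdegree (G ×K₂) o v   ∎))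
      ... | w , 1F , refl = +-cancelˡ-≡ (indegree (G ×K₂) o v) _ _ (begin
        indegree (G ×K₂) o v + indegree (G ×K₂) o v    ≡⟨ double (indegree (G ×K₂) o v) ⟨
        2 * indegree (G ×K₂) o v                       ≡⟨ cong (2 *_) (degreeIn-twist-1F w) ⟨
        2 * degreeIn (G ×K₂) (twist (size G) o) v      ≡⟨ half v ⟩
        degree (G ×K₂) v                               ≡⟨ degree≡indegree+outdegree (G ×K₂) o v ⟩
        indegree (G ×K₂) o v + outdegree (G ×K₂) o v   ∎)

  ε-×K₂ : ε (G ×K₂) ≡ h (G ×K₂)
  ε-×K₂ = begin
    ε (G ×K₂)
      ≡⟨ #Subset≡∑⊆ (isEulerianOrientation? (G ×K₂)) ⟩
    ∑⊆ (𝟙 ∘ isEulerianOrientation? (G ×K₂))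
      ≡⟨ (∑⊆-cong λ o → 𝟙-⇔ (halfGraph-twist o) (isEulerianOrientation? (G ×K₂) o) (isHalfGraph? (G ×K₂) (twist (size G) o))) ⟩
    ∑⊆ (𝟙 ∘ isHalfGraph? (G ×K₂) ∘ twist (size G))
      ≡⟨ ∑⊆-twist (size G) _ ⟩
    ∑⊆ (𝟙 ∘ isHalfGraph? (G ×K₂))
      ≡⟨ #Subset≡∑⊆ (isHalfGraph? (G ×K₂)) ⟨
    h (G ×K₂) ∎

theorem1p4 : (G : Graph) → Eulerian G →
    (ε (G ×K₂) ≡ h (G ×K₂)) × (h (G ×K₂) ≡ ∑⊆ (λ A → ε (G ↾ A) * h (G ↾ ∁ A)))
theorem1p4 G _ = ε-×K₂ G , h-×K₂ G
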